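{- Let $\mathsf{GHZ}^n$ denote the $n$-fold parallel repetition of the GHZ game (defined in the context). There exist absolute constants $c>0$ and $n_0\in\mathbb{N}$ such that for all $n\ge n_0$, the value of $\mathsf{GHZ}^n$ is at most $n^{ -c}$. (That is, $\mathsf{val}(\mathsf{GHZ}^n)\le n^{ -\Omega(1)}$.)
   Context: The GHZ game is the 3-player game in which a referee samples a query $(q_1,q_2,q_3)$ uniformly from $\{(0,0,0),(0,1,1),(1,0,1),(1,1,0)\}\subseteq \mathbb{F}_2^3$ and sends $q_j$ to player $j$; each player $j$ returns an answer $a_j\in\mathbb{F}_2$ depending only on $q_j$; the players win iff $a_1+a_2+a_3 \equiv q_1\lor q_2\lor q_3 \pmod 2$. The $n$-fold parallel repetition: the referee samples $n$ independent queries $(q_1^i,q_2^i,q_3^i)$, $i\in[n]$, from this distribution; player $j$ receives $(q_j^1,\dots,q_j^n)$ and outputs $(a_j^1,\dots,a_j^n)\in\mathbb{F}_2^n$ as a function of its own input only; the players win iff they win the GHZ game in every coordinate $i\in[n]$. The value of a game is the maximum, over all deterministic strategies $f=f_1\times f_2\times f_3$ (each $f_j$ a function from player $j$'s inputs to its answers), of the probability of winning. -}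

module Defs where

open import Data.Nat using (ℕ; zero; suc; _+_)
open import Data.Bool using (Bool; true; false; _xor_; _∨_; _∧_; if_then_else_)
open import Data.Fin using (Fin; zero; suc)
open import Data.Vec using (Vec; []; _∷_; lookup)
open import Data.Product using (_×_; _,_)

ghzQuery : Fin 4 → Bool × Bool × Bool
ghzQuery zero                   = false , false , false
ghzQuery (suc zero)             = false , true  , true
ghzQuery (suc (suc zero))       = true  , false , true
ghzQuery (suc (suc (suc zero))) = true  , true  , false

q₁ q₂ q₃ : ∀ {n} → Vec (Fin 4) n → Vec Bool n
q₁ [] = []
q₁ (i ∷ v) with ghzQuery i
... | (a , _ , _) = a ∷ q₁ v
q₂ [] = []
q₂ (i ∷ v) with ghzQuery i
... | (_ , b , _) = b ∷ q₂ v
q₃ [] = []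
q₃ (i ∷ v) with ghzQuery i
... | (_ , _ , c) = c ∷ q₃ v

ghzWin1 : Fin 4 → Bool → Bool → Bool → Bool
ghzWin1 i a₁ a₂ a₃ with ghzQuery i
... | (x , y , z) = not≠ ((a₁ xor a₂) xor a₃) (x ∨ y ∨ z)
  where
  not≠ : Bool → Bool → Bool
  not≠ true  true  = true
  not≠ false false = true
  not≠ _     _     = false

allWin : ∀ {n} → Vec (Fin 4) n → Vec Bool n → Vec Bool n → Vec Bool n → Bool
allWin [] [] [] [] = true
allWin (i ∷ v) (a ∷ as) (b ∷ bs) (c ∷ cs) = ghzWin1 i a b c ∧ allWin v as bs cs

Strategy : ℕ → Set
Strategy n = Vec Bool n → Vec Bool n

count : ∀ n → (Vec (Fin 4) n → Bool) → ℕ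
count zero    P = if P [] then 1 else 0
count (suc n) P = count n (λ v → P (zero ∷ v))
                + count n (λ v → P (suc zero ∷ v))
                + count n (λ v → P (suc (suc zero) ∷ v))
                + count n (λ v → P (suc (suc (suc zero)) ∷ v))

-- number of the 4^n equally likely query tuples on which (f₁,f₂,f₃) wins GHZ^n;
-- the winning probability is winCount n f₁ f₂ f₃ / 4 ^ n
winCount : ∀ n → Strategy n → Strategy n → Strategy n → ℕ
winCount n f₁ f₂ f₃ = count n (λ v → allWin v (f₁ (q₁ v)) (f₂ (q₂ v)) (f₃ (q₃ v)))

{-# OPTIONS --safe #-}

-- A query tuple is a pair (x , y) of vectors over F₂, the third query being x ⊕ y;
-- view the winning pairs as the edges of a bipartite graph on N + N vertices, N = 2ⁿ,
-- coloured by x ⊕ y.  If v is the probability of winning, two applications of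
-- Cauchy–Schwarz give at least v⁴N⁴ squares x, x′, y, y′ of winning pairs, and a third
-- one, over the fibres of (x , y , x′ ⊕ y′), gives at least v⁸N⁵ pairs of squares
-- sharing x, y and z = x′ ⊕ y′.  Among their edges is a walk of five edges
-- whose first and last edge have the same colour z.  Adding up the winning conditions
-- f₁ x + f₂ y + f₃ (x + y) = x ∨ y along the walk, the unknown answers cancel except for
-- some that depend on four of the five parameters only, while the right-hand sides
-- add up to the fifth parameter plus a function of the other four.  So there are at
-- most N⁴ pairs of squares, whence v⁸ ≤ 1/N.  (This is the sums-differences
-- argument of Katz and Tao, in the group (Z/4)ⁿ.)
module Submission where

open import Defs
open import Algebra.Properties.CommutativeSemigroup using (interchange)
open import Data.Bool using (Bool; true; false; _xor_; _∨_; _∧_; if_then_else_)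
open import Data.Bool.Properties using (_≟_; ∧-conicalˡ; ∧-conicalʳ; xor-assoc; xor-comm; xor-same; xor-identityʳ)
open import Data.Fin using (Fin; zero; suc)
open import Data.Nat using (ℕ; zero; suc; _+_; _*_; _^_; _≤_; z≤n; s≤s)
open import Data.Nat.Properties hiding (_≟_)
open import Data.Nat.Tactic.RingSolver using (solve-∀)
open import Data.Product using (_×_; _,_; ∃-syntax)
open import Data.Sum using (inj₁; inj₂)
open import Data.Vec using (Vec; []; _∷_; lookup; zipWith; tabulate)
open import Data.Vec.Properties using (lookup-zipWith; ∷-injectiveʳ; tabulate∘lookup; tabulate-cong)
open import Function using (case_of_)
open import Relation.Binary.PropositionalEquality
open import Relation.Nullary using (Dec; contradiction)
open import Relation.Nullary.Decidable using (map′; _×-dec_; _→-dec_; from-yes)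

-- Sums over the cube F₂ⁿ.

∑ : ∀ {n} → (Vec Bool n → ℕ) → ℕ
∑ {zero}  g = g []
∑ {suc n} g = ∑ (λ v → g (false ∷ v)) + ∑ (λ v → g (true ∷ v))

∑-syntax : ∀ {n} → (Vec Bool n → ℕ) → ℕ
∑-syntax = ∑

syntax ∑-syntax (λ v → e) = ∑[ v ] e
infix 5 ∑-syntax

∑-cong : ∀ {n} {g h : Vec Bool n → ℕ} → (∀ v → g v ≡ h v) → ∑ g ≡ ∑ h
∑-cong {zero}  eq = eq []
∑-cong {suc n} eq = cong₂ _+_ (∑-cong λ v → eq (false ∷ v)) (∑-cong λ v → eq (true ∷ v))

∑-mono : ∀ {n} {g h : Vec Bool n → ℕ} → (∀ v → g v ≤ h v) → ∑ g ≤ ∑ h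
∑-mono {zero}  le = le []
∑-mono {suc n} le = +-mono-≤ (∑-mono λ v → le (false ∷ v)) (∑-mono λ v → le (true ∷ v))

∑-+ : ∀ {n} (g h : Vec Bool n → ℕ) → (∑[ v ] g v + h v) ≡ ∑ g + ∑ h
∑-+ {zero}  g h = refl
∑-+ {suc n} g h = trans
  (cong₂ _+_ (∑-+ (λ v → g (false ∷ v)) _) (∑-+ (λ v → g (true ∷ v)) _))
  (interchange +-commutativeSemigroup (∑ λ v → g (false ∷ v)) _ _ _)

∑-*ˡ : ∀ {n} c (g : Vec Bool n → ℕ) → (∑[ v ] c * g v) ≡ c * ∑ g
∑-*ˡ {zero}  c g = refl
∑-*ˡ {suc n} c g = trans
  (cong₂ _+_ (∑-*ˡ c (λ v → g (false ∷ v))) (∑-*ˡ c (λ v → g (true ∷ v))))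
  (sym (*-distribˡ-+ c (∑ λ v → g (false ∷ v)) _))

∑-swap : ∀ {m n} (g : Vec Bool m → Vec Bool n → ℕ) →
         (∑[ u ] ∑[ v ] g u v) ≡ (∑[ v ] ∑[ u ] g u v)
∑-swap {zero}  g = refl
∑-swap {suc m} g = trans
  (cong₂ _+_ (∑-swap (λ u → g (false ∷ u))) (∑-swap (λ u → g (true ∷ u))))
  (sym (∑-+ _ (λ v → ∑[ u ] g (true ∷ u) v)))

∑≤ : ∀ {n} c {g : Vec Bool n → ℕ} → (∀ v → g v ≤ c) → ∑ g ≤ 2 ^ n * c
∑≤ {zero}  c le = ≤-trans (le []) (≤-reflexive (sym (*-identityˡ c)))
∑≤ {suc n} c le = ≤-trans
  (+-mono-≤ (∑≤ c λ v → le (false ∷ v)) (∑≤ c λ v → le (true ∷ v)))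
  (≤-reflexive (double (2 ^ n) c))
  where
  double : ∀ N c → N * c + N * c ≡ 2 * N * c
  double = solve-∀

∑*∑ : ∀ {n} (h : Vec Bool n → ℕ) → ∑ h * ∑ h ≡ (∑[ s ] ∑[ t ] h s * h t)
∑*∑ h = trans (trans (sym (∑-*ˡ (∑ h) h)) (∑-cong λ s → *-comm (∑ h) (h s)))
              (∑-cong λ s → sym (∑-*ˡ (h s) h))

-- Cauchy–Schwarz

-- The two sides differ by the square of m - n. Ordering m and n first makes this difference a
-- natural number d.
[m+n]²≤2[m²+n²] : ∀ m n → (m + n) * (m + n) ≤ 2 * (m * m + n * n)
[m+n]²≤2[m²+n²] m n with ≤-total m n
... | inj₁ m≤n with m≤n⇒∃[o]m+o≡n m≤n
...   | d , refl = ≤-trans (m≤m+n _ (d * d)) (≤-reflexive (identity m d))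
  where
  identity : ∀ m d → (m + (m + d)) * (m + (m + d)) + d * d ≡ 2 * (m * m + (m + d) * (m + d))
  identity = solve-∀
[m+n]²≤2[m²+n²] m n | inj₂ n≤m with m≤n⇒∃[o]m+o≡n n≤m
...   | d , refl = ≤-trans (m≤m+n _ (d * d)) (≤-reflexive (identity n d))
  where
  identity : ∀ n d → ((n + d) + n) * ((n + d) + n) + d * d ≡ 2 * ((n + d) * (n + d) + n * n)
  identity = solve-∀

-- Induction on the dimension: the cube splits by its first bit, and the two-term inequality
-- supplies the extra factor 2.
cauchy-schwarz : ∀ {n} (g : Vec Bool n → ℕ) → ∑ g * ∑ g ≤ 2 ^ n * (∑[ v ] g v * g v)
cauchy-schwarz {zero}  g = ≤-reflexive (sym (*-identityˡ _))
cauchy-schwarz {suc n} g = begin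
  (∑ g₀ + ∑ g₁) * (∑ g₀ + ∑ g₁)                ≤⟨ [m+n]²≤2[m²+n²] (∑ g₀) (∑ g₁) ⟩
  2 * (∑ g₀ * ∑ g₀ + ∑ g₁ * ∑ g₁)              ≤⟨ *-monoʳ-≤ 2 (+-mono-≤ (cauchy-schwarz g₀) (cauchy-schwarz g₁)) ⟩
  2 * (2 ^ n * A + 2 ^ n * B)                  ≡⟨ cong (2 *_) (*-distribˡ-+ (2 ^ n) A B) ⟨
  2 * (2 ^ n * (A + B))                        ≡⟨ *-assoc 2 (2 ^ n) (A + B) ⟨
  2 ^ suc n * (A + B)                          ∎
  where
  open ≤-Reasoning
  g₀ g₁ : Vec Bool n → ℕ
  g₀ v = g (false ∷ v)
  g₁ v = g (true ∷ v)
  A = ∑[ v ] g₀ v * g₀ v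
  B = ∑[ v ] g₁ v * g₁ v

-- For iterated sums: the outer sum costs its own factor `2 ^ m`, on top of the factor `c` already
-- paid inside.
cauchy-schwarz-step : ∀ {m n} c (g : Vec Bool m → ℕ) (h : Vec Bool m → Vec Bool n → ℕ) →
  (∀ u → g u * g u ≤ c * ∑ (h u)) → ∑ g * ∑ g ≤ 2 ^ m * (c * (∑[ u ] ∑[ v ] h u v))
cauchy-schwarz-step {m} c g h le = ≤-trans (cauchy-schwarz g)
  (*-monoʳ-≤ (2 ^ m) (≤-trans (∑-mono le) (≤-reflexive (∑-*ˡ c (λ u → ∑ (h u))))))

cauchy-schwarz₂ : ∀ {n} (g : Vec Bool n → Vec Bool n → ℕ) →
  (∑[ u ] ∑[ v ] g u v) * (∑[ u ] ∑[ v ] g u v) ≤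
  2 ^ n * (2 ^ n * (∑[ u ] ∑[ v ] g u v * g u v))
cauchy-schwarz₂ {n} g = cauchy-schwarz-step (2 ^ n) (λ u → ∑ (g u))
  (λ u v → g u v * g u v) (λ u → cauchy-schwarz (g u))

cauchy-schwarz₃ : ∀ {n} (g : Vec Bool n → Vec Bool n → Vec Bool n → ℕ) →
  (∑[ u ] ∑[ v ] ∑[ w ] g u v w) * (∑[ u ] ∑[ v ] ∑[ w ] g u v w) ≤
  2 ^ n * (2 ^ n * 2 ^ n * (∑[ u ] ∑[ v ] ∑[ w ] g u v w * g u v w))
cauchy-schwarz₃ {n} g = cauchy-schwarz-step (2 ^ n * 2 ^ n) (λ u → ∑[ v ] ∑ (g u v))
  (λ u v → ∑[ w ] g u v w * g u v w)
  (λ u → ≤-trans (cauchy-schwarz₂ (g u)) (≤-reflexive (sym (*-assoc (2 ^ n) (2 ^ n) _))))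

-- Addition and translation in F₂ⁿ.

all-Bool? : {P : Bool → Set} → (∀ b → Dec (P b)) → Dec (∀ b → P b)
all-Bool? P? = map′ (λ { (p , q) false → p ; (p , q) true → q }) (λ f → f false , f true)
                    (P? false ×-dec P? true)

infixl 6 _⊕_
_⊕_ : ∀ {n} → Vec Bool n → Vec Bool n → Vec Bool n
_⊕_ = zipWith _xor_

xor-cancel : ∀ a s → (a xor s) xor s ≡ a
xor-cancel a s = trans (xor-assoc a s s) (trans (cong (a xor_) (xor-same s)) (xor-identityʳ a))

⊕-cancel : ∀ {n} (a s : Vec Bool n) → a ⊕ s ⊕ s ≡ a
⊕-cancel []       []       = refl
⊕-cancel (a ∷ as) (s ∷ ss) = cong₂ _∷_ (xor-cancel a s) (⊕-cancel as ss)

xor-translate : ∀ a b s → (a xor s) xor (b xor s) ≡ a xor b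
-- The whole truth table is decided by evaluation, and `from-yes` extracts the proof.
xor-translate = from-yes (all-Bool? λ a → all-Bool? λ b → all-Bool? λ s →
  ((a xor s) xor (b xor s)) ≟ (a xor b))

⊕-translate : ∀ {n} (a b s : Vec Bool n) → (a ⊕ s) ⊕ (b ⊕ s) ≡ a ⊕ b
⊕-translate []       []       []       = refl
⊕-translate (a ∷ as) (b ∷ bs) (s ∷ ss) = cong₂ _∷_ (xor-translate a b s) (⊕-translate as bs ss)

⊕-swapʳ : ∀ {n} (a b c : Vec Bool n) → a ⊕ b ⊕ c ≡ a ⊕ c ⊕ b
⊕-swapʳ []       []       []       = refl
⊕-swapʳ (a ∷ as) (b ∷ bs) (c ∷ cs) = cong₂ _∷_
  (trans (xor-assoc a b c) (trans (cong (a xor_) (xor-comm b c)) (sym (xor-assoc a c b))))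
  (⊕-swapʳ as bs cs)

∑-translate : ∀ {n} (c : Vec Bool n) (g : Vec Bool n → ℕ) → ∑ g ≡ (∑[ v ] g (v ⊕ c))
∑-translate []          g = refl
∑-translate (false ∷ c) g =
  cong₂ _+_ (∑-translate c λ v → g (false ∷ v)) (∑-translate c λ v → g (true ∷ v))
-- A leading `true` in the shift exchanges the two halves of the cube.
∑-translate (true ∷ c)  g = trans (+-comm (∑ λ v → g (false ∷ v)) _)
  (cong₂ _+_ (∑-translate c λ v → g (true ∷ v)) (∑-translate c λ v → g (false ∷ v)))

-- Indicator functions.

⟦_⟧ : Bool → ℕ
⟦ b ⟧ = if b then 1 else 0

⟦∧⟧ : ∀ p q → ⟦ p ⟧ * ⟦ q ⟧ ≡ ⟦ p ∧ q ⟧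
⟦∧⟧ false q = refl
⟦∧⟧ true  q = *-identityˡ ⟦ q ⟧

∑-pairs : ∀ {n} (P : Vec Bool n → Bool) →
  (∑[ v ] ⟦ P v ⟧) * (∑[ v ] ⟦ P v ⟧) ≡ (∑[ s ] ∑[ t ] ⟦ P s ∧ P t ⟧)
∑-pairs P = trans (∑*∑ (λ v → ⟦ P v ⟧)) (∑-cong λ s → ∑-cong λ t → ⟦∧⟧ (P s) (P t))

∑-empty : ∀ {n} (P : Vec Bool n → Bool) → (∀ v → P v ≢ true) → (∑[ v ] ⟦ P v ⟧) ≡ 0
∑-empty {n} P none = n≤0⇒n≡0 (≤-trans (∑≤ 0 vanish) (≤-reflexive (*-zeroʳ (2 ^ n))))
  where
  vanish : ∀ v → ⟦ P v ⟧ ≤ 0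
  vanish v with P v in eq
  ... | false = z≤n
  ... | true  = contradiction eq (none v)

-- The half of the cube whose first bit differs from that of `k` contains no solution; induction
-- handles the other half.
∑-atMostOne : ∀ {n} (k : Vec Bool n) (P : Vec Bool n → Bool) →
  (∀ v → P v ≡ true → v ≡ k) → (∑[ v ] ⟦ P v ⟧) ≤ 1
∑-atMostOne []          P only with P []
... | false = z≤n
... | true  = ≤-refl
∑-atMostOne (false ∷ k) P only = subst (λ m → (∑[ v ] ⟦ P (false ∷ v) ⟧) + m ≤ 1)
  (sym (∑-empty (λ v → P (true ∷ v)) λ v p → case only _ p of λ ()))
  (≤-trans (≤-reflexive (+-identityʳ _))
           (∑-atMostOne k (λ v → P (false ∷ v)) λ v p → ∷-injectiveʳ (only _ p)))
∑-atMostOne (true ∷ k)  P only = subst (λ m → m + (∑[ v ] ⟦ P (true ∷ v) ⟧) ≤ 1)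
  (sym (∑-empty (λ v → P (false ∷ v)) λ v p → case only _ p of λ ()))
  (∑-atMostOne k (λ v → P (true ∷ v)) λ v p → ∷-injectiveʳ (only _ p))

-- Queries as pairs of bit vectors

-- Inverts `ghzQuery` on its first two bits: the four allowed queries are the triples with sum zero,
-- so these two bits are free and fix the third.
letter : Bool → Bool → Fin 4
letter false false = zero
letter false true  = suc zero
letter true  false = suc (suc zero)
letter true  true  = suc (suc (suc zero))

queries : ∀ {n} → Vec Bool n → Vec Bool n → Vec (Fin 4) n
queries = zipWith letter

q₁-queries : ∀ {n} (x y : Vec Bool n) → q₁ (queries x y) ≡ x
q₁-queries []          []          = refl
q₁-queries (false ∷ x) (false ∷ y) = cong (false ∷_) (q₁-queries x y)
q₁-queries (false ∷ x) (true  ∷ y) = cong (false ∷_) (q₁-queries x y)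
q₁-queries (true  ∷ x) (false ∷ y) = cong (true ∷_) (q₁-queries x y)
q₁-queries (true  ∷ x) (true  ∷ y) = cong (true ∷_) (q₁-queries x y)

q₂-queries : ∀ {n} (x y : Vec Bool n) → q₂ (queries x y) ≡ y
q₂-queries []          []          = refl
q₂-queries (false ∷ x) (false ∷ y) = cong (false ∷_) (q₂-queries x y)
q₂-queries (false ∷ x) (true  ∷ y) = cong (true ∷_) (q₂-queries x y)
q₂-queries (true  ∷ x) (false ∷ y) = cong (false ∷_) (q₂-queries x y)
q₂-queries (true  ∷ x) (true  ∷ y) = cong (true ∷_) (q₂-queries x y)

q₃-queries : ∀ {n} (x y : Vec Bool n) → q₃ (queries x y) ≡ x ⊕ y
q₃-queries []          []          = refl
q₃-queries (false ∷ x) (false ∷ y) = cong (false ∷_) (q₃-queries x y)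
q₃-queries (false ∷ x) (true  ∷ y) = cong (true ∷_) (q₃-queries x y)
q₃-queries (true  ∷ x) (false ∷ y) = cong (true ∷_) (q₃-queries x y)
q₃-queries (true  ∷ x) (true  ∷ y) = cong (false ∷_) (q₃-queries x y)

count-queries : ∀ n (P : Vec (Fin 4) n → Bool) →
  count n P ≡ (∑[ x ] ∑[ y ] ⟦ P (queries x y) ⟧)
count-queries zero    P = refl
count-queries (suc n) P = begin
  C₀₀ + C₀₁ + C₁₀ + C₁₁    ≡⟨ +-assoc (C₀₀ + C₀₁) C₁₀ C₁₁ ⟩
  (C₀₀ + C₀₁) + (C₁₀ + C₁₁)  ≡⟨ cong₂ _+_ (cong₂ _+_ (count-queries n _) (count-queries n _))
                                          (cong₂ _+_ (count-queries n _) (count-queries n _)) ⟩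
  (∑∑ false false + ∑∑ false true) + (∑∑ true false + ∑∑ true true)
                             ≡⟨ cong₂ _+_ (∑-+ (inner false false) (inner false true))
                                          (∑-+ (inner true false) (inner true true)) ⟨
  (∑[ x ] ∑[ y ] ⟦ P (queries x y) ⟧) ∎
  where
  open ≡-Reasoning
  C₀₀ = count n λ v → P (letter false false ∷ v)
  C₀₁ = count n λ v → P (letter false true ∷ v)
  C₁₀ = count n λ v → P (letter true false ∷ v)
  C₁₁ = count n λ v → P (letter true true ∷ v)
  inner : Bool → Bool → Vec Bool n → ℕ
  inner a b x = ∑[ y ] ⟦ P (letter a b ∷ queries x y) ⟧
  ∑∑ : Bool → Bool → ℕ
  ∑∑ a b = ∑ (inner a b)

-- The third query bit is `x xor y`, which is true only if `x` or `y` is, so it adds nothing to the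
-- disjunction.
ghzWin1⇒xor≡∨ : ∀ x y a b c → ghzWin1 (letter x y) a b c ≡ true → (a xor b) xor c ≡ x ∨ y
ghzWin1⇒xor≡∨ = from-yes (all-Bool? λ x → all-Bool? λ y → all-Bool? λ a → all-Bool? λ b →
  all-Bool? λ c → (ghzWin1 (letter x y) a b c ≟ true) →-dec (((a xor b) xor c) ≟ (x ∨ y)))

allWin⇒xor≡∨ : ∀ {n} (x y as bs cs : Vec Bool n) → allWin (queries x y) as bs cs ≡ true →
  ∀ i → (lookup as i xor lookup bs i) xor lookup cs i ≡ lookup x i ∨ lookup y i
allWin⇒xor≡∨ (x ∷ xs) (y ∷ ys) (a ∷ as) (b ∷ bs) (c ∷ cs) win zero    =
  ghzWin1⇒xor≡∨ x y a b c (∧-conicalˡ _ _ win)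
allWin⇒xor≡∨ (x ∷ xs) (y ∷ ys) (a ∷ as) (b ∷ bs) (c ∷ cs) win (suc i) =
  allWin⇒xor≡∨ xs ys as bs cs (∧-conicalʳ (ghzWin1 (letter x y) a b c) _ win) i

-- Boolean identities along the five-edge walk.

xor₅ : Bool → Bool → Bool → Bool → Bool → Bool
xor₅ a b c d e = a xor (b xor (c xor (d xor e)))

-- The answers at the four inner vertices of the walk (`p`, `p″`, `q`, `q′`) occur twice and cancel,
-- as does the answer `r₃` to the colour shared by the first and last edge.
path-sum : ∀ p p′ p″ q q′ q″ r₁ r₂ r₃ r₄ →
  xor₅ r₁ r₂ p′ r₄ q″ ≡
  xor₅ ((p xor q) xor r₁) ((p xor q′) xor r₂) ((p′ xor q′) xor r₃)
       ((p″ xor q) xor r₄) ((p″ xor q″) xor r₃)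
path-sum = from-yes (
  all-Bool? λ p → all-Bool? λ p′ → all-Bool? λ p″ →
  all-Bool? λ q → all-Bool? λ q′ → all-Bool? λ q″ →
  all-Bool? λ r₁ → all-Bool? λ r₂ → all-Bool? λ r₃ → all-Bool? λ r₄ →
  xor₅ r₁ r₂ p′ r₄ q″ ≟
  xor₅ ((p xor q) xor r₁) ((p xor q′) xor r₂) ((p′ xor q′) xor r₃)
       ((p″ xor q) xor r₄) ((p″ xor q″) xor r₃))

-- Expand each `x ∨ y` as x + y + xy over F₂, with s² = s. Every product of `s` with another
-- variable then occurs twice, while `s` alone occurs five times and survives.
path-solve : ∀ a b c e s →
  s ≡ xor₅ ((a xor s) ∨ (b xor s)) ((a xor s) ∨ s) (c ∨ s)
           (((c xor s) xor e) ∨ (b xor s)) (((c xor s) xor e) ∨ e)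
      xor xor₅ (a ∧ b) (b ∧ c) (b ∧ e) (c ∧ e) c
path-solve = from-yes (
  all-Bool? λ a → all-Bool? λ b → all-Bool? λ c → all-Bool? λ e → all-Bool? λ s →
  s ≟ (xor₅ ((a xor s) ∨ (b xor s)) ((a xor s) ∨ s) (c ∨ s)
            (((c xor s) xor e) ∨ (b xor s)) (((c xor s) xor e) ∨ e)
       xor xor₅ (a ∧ b) (b ∧ c) (b ∧ e) (c ∧ e) c))

-- Counting winning configurations

module _ {n} (f₁ f₂ f₃ : Strategy n) where

  win : Vec Bool n → Vec Bool n → Bool
  win x y = allWin (queries x y) (f₁ x) (f₂ y) (f₃ (x ⊕ y))

  square : (x x′ y y′ : Vec Bool n) → Bool
  square x x′ y y′ = (win x y ∧ win x′ y) ∧ (win x y′ ∧ win x′ y′)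

  -- `s` and `e` are the y′-vertices of the two squares. Each x′ is recovered from the common colour
  -- `z` of the edge (x′ , y′), as `z ⊕ s` or `z ⊕ e`.
  gluedSquares : (x y z s e : Vec Bool n) → Bool
  gluedSquares x y z s e = square x (z ⊕ s) y s ∧ square x (z ⊕ e) y e

  #edges #cherries #squares #gluedSquares : ℕ
  #edges        = ∑[ x ] ∑[ y ] ⟦ win x y ⟧
  #cherries     = ∑[ x ] ∑[ x′ ] ∑[ y ] ⟦ win x y ∧ win x′ y ⟧
  #squares      = ∑[ x ] ∑[ y ] ∑[ z ] ∑[ s ] ⟦ square x (z ⊕ s) y s ⟧
  #gluedSquares = ∑[ x ] ∑[ y ] ∑[ z ] ∑[ s ] ∑[ e ] ⟦ gluedSquares x y z s e ⟧

  winCount≡#edges : winCount n f₁ f₂ f₃ ≡ #edges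
  winCount≡#edges = trans
    (count-queries n λ v → allWin v (f₁ (q₁ v)) (f₂ (q₂ v)) (f₃ (q₃ v)))
    (∑-cong λ x → ∑-cong λ y → cong ⟦_⟧ (relabel x y))
    where
    relabel : ∀ x y → allWin (queries x y) (f₁ (q₁ (queries x y))) (f₂ (q₂ (queries x y)))
                             (f₃ (q₃ (queries x y))) ≡ win x y
    relabel x y rewrite q₁-queries x y | q₂-queries x y | q₃-queries x y = refl

  -- Cauchy-Schwarz over y: two winning pairs with the same y form a cherry. The last swaps bring y
  -- innermost for the next application.
  #edges² : #edges * #edges ≤ 2 ^ n * #cherries
  #edges² = begin
    #edges * #edges
      ≡⟨ cong (λ m → m * m) (∑-swap λ x y → ⟦ win x y ⟧) ⟩
    (∑[ y ] ∑[ x ] ⟦ win x y ⟧) * (∑[ y ] ∑[ x ] ⟦ win x y ⟧)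
      ≤⟨ cauchy-schwarz (λ y → ∑[ x ] ⟦ win x y ⟧) ⟩
    2 ^ n * (∑[ y ] (∑[ x ] ⟦ win x y ⟧) * (∑[ x ] ⟦ win x y ⟧))
      ≡⟨ cong (2 ^ n *_) (∑-cong λ y → ∑-pairs λ x → win x y) ⟩
    2 ^ n * (∑[ y ] ∑[ x ] ∑[ x′ ] ⟦ win x y ∧ win x′ y ⟧)
      ≡⟨ cong (2 ^ n *_) (∑-swap λ y x → ∑[ x′ ] ⟦ win x y ∧ win x′ y ⟧) ⟩
    2 ^ n * (∑[ x ] ∑[ y ] ∑[ x′ ] ⟦ win x y ∧ win x′ y ⟧)
      ≡⟨ cong (2 ^ n *_) (∑-cong λ x → ∑-swap λ y x′ → ⟦ win x y ∧ win x′ y ⟧) ⟩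
    2 ^ n * #cherries ∎
    where open ≤-Reasoning

  -- Cauchy-Schwarz over (x , x′): two cherries with the same ends close up to a square, possibly
  -- degenerate.
  #cherries² : #cherries * #cherries ≤ 2 ^ n * (2 ^ n * #squares)
  #cherries² = begin
    #cherries * #cherries
      ≤⟨ cauchy-schwarz₂ (λ x x′ → ∑[ y ] ⟦ win x y ∧ win x′ y ⟧) ⟩
    2 ^ n * (2 ^ n * _)
      ≡⟨ cong (λ m → 2 ^ n * (2 ^ n * m)) (∑-cong λ x → regroup x) ⟩
    2 ^ n * (2 ^ n * #squares) ∎
    where
    open ≤-Reasoning
    regroup : ∀ x →
      (∑[ x′ ] (∑[ y ] ⟦ win x y ∧ win x′ y ⟧) * (∑[ y ] ⟦ win x y ∧ win x′ y ⟧)) ≡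
      (∑[ y ] ∑[ z ] ∑[ s ] ⟦ square x (z ⊕ s) y s ⟧)
    regroup x = begin-equality
      (∑[ x′ ] (∑[ y ] ⟦ win x y ∧ win x′ y ⟧) * (∑[ y ] ⟦ win x y ∧ win x′ y ⟧))
        ≡⟨ ∑-cong (λ x′ → ∑-pairs λ y → win x y ∧ win x′ y) ⟩
      (∑[ x′ ] ∑[ y ] ∑[ s ] ⟦ square x x′ y s ⟧)
        ≡⟨ ∑-swap (λ x′ y → ∑[ s ] ⟦ square x x′ y s ⟧) ⟩
      (∑[ y ] ∑[ x′ ] ∑[ s ] ⟦ square x x′ y s ⟧)
        ≡⟨ ∑-cong (λ y → ∑-swap λ x′ s → ⟦ square x x′ y s ⟧) ⟩
      (∑[ y ] ∑[ s ] ∑[ x′ ] ⟦ square x x′ y s ⟧)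
        -- Substituting x′ = `z ⊕ s` makes the colour `z` of (x′ , s) a coordinate, which the next
        -- Cauchy-Schwarz holds fixed.
        ≡⟨ ∑-cong (λ y → ∑-cong λ s → ∑-translate s λ x′ → ⟦ square x x′ y s ⟧) ⟩
      (∑[ y ] ∑[ s ] ∑[ z ] ⟦ square x (z ⊕ s) y s ⟧)
        ≡⟨ ∑-cong (λ y → ∑-swap λ s z → ⟦ square x (z ⊕ s) y s ⟧) ⟩
      (∑[ y ] ∑[ z ] ∑[ s ] ⟦ square x (z ⊕ s) y s ⟧) ∎

  #squares² : #squares * #squares ≤ 2 ^ n * (2 ^ n * 2 ^ n * #gluedSquares)
  #squares² = ≤-trans
    (cauchy-schwarz₃ λ x y z → ∑[ s ] ⟦ square x (z ⊕ s) y s ⟧)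
    (≤-reflexive (cong (λ m → 2 ^ n * (2 ^ n * 2 ^ n * m))
      (∑-cong λ x → ∑-cong λ y → ∑-cong λ z → ∑-pairs λ s → square x (z ⊕ s) y s)))

  -- The third query enters through an equation, so that each edge can name it in the form in which
  -- it cancels or is free of `s`.
  win⇒ : ∀ {x y z} → x ⊕ y ≡ z → win x y ≡ true → ∀ i →
         (lookup (f₁ x) i xor lookup (f₂ y) i) xor lookup (f₃ z) i ≡ lookup x i ∨ lookup y i
  win⇒ {x} {y} refl = allWin⇒xor≡∨ x y (f₁ x) (f₂ y) (f₃ (x ⊕ y))

  -- The winning conditions solved for the fifth parameter: the answers left by `path-sum` plus the
  -- remainder polynomial of `path-solve`.
  key : (a b c e : Vec Bool n) → Vec Bool n
  key a b c e = tabulate λ i →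
    let l = λ v → lookup v i in
    xor₅ (l (f₃ (a ⊕ b))) (l (f₃ a)) (l (f₁ c)) (l (f₃ (c ⊕ e ⊕ b))) (l (f₂ e))
    xor xor₅ (l a ∧ l b) (l b ∧ l c) (l b ∧ l e) (l c ∧ l e) (l c)

  -- The walk c, s, a ⊕ s, b ⊕ s, c ⊕ s ⊕ e, e consists of five winning pairs,
  -- the first and last of which have the same third query c ⊕ s.
  gluedSquares⇒key : ∀ a b c e s →
    gluedSquares (a ⊕ s) (b ⊕ s) (c ⊕ s) s e ≡ true → s ≡ key a b c e
  gluedSquares⇒key a b c e s glued =
    trans (sym (tabulate∘lookup s)) (tabulate-cong λ i →
      -- Coordinatewise: `path-solve` expresses the bit of `s` by the five right-hand sides, the
      -- edges trade these for answers, and `path-sum` cancels.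
      trans (path-solve (lookup a i) (lookup b i) (lookup c i) (lookup e i) (lookup s i))
            (cong (_xor _) (sym (trans
              (path-sum (l f₁ (a ⊕ s) i) (l f₁ c i) (l f₁ (c ⊕ s ⊕ e) i)
                        (l f₂ (b ⊕ s) i) (l f₂ s i) (l f₂ e i)
                        (l f₃ (a ⊕ b) i) (l f₃ a i) (l f₃ (c ⊕ s) i) (l f₃ (c ⊕ e ⊕ b) i))
              (xor₅-cong (edge₁ i) (edge₂ i) (edge₃ i) (edge₄ i) (edge₅ i))))))
    where
    l : Strategy n → Vec Bool n → Fin n → Bool
    l f v = lookup (f v)

    xor₅-cong : ∀ {a a′ b b′ c c′ d d′ e e′} →
      a ≡ a′ → b ≡ b′ → c ≡ c′ → d ≡ d′ → e ≡ e′ → xor₅ a b c d e ≡ xor₅ a′ b′ c′ d′ e′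
    xor₅-cong refl refl refl refl refl = refl

    squareₛ : square (a ⊕ s) (c ⊕ s ⊕ s) (b ⊕ s) s ≡ true
    squareₛ = ∧-conicalˡ _ _ glued
    squareₑ : square (a ⊕ s) (c ⊕ s ⊕ e) (b ⊕ s) e ≡ true
    squareₑ = ∧-conicalʳ (square (a ⊕ s) (c ⊕ s ⊕ s) (b ⊕ s) s) _ glued

    win₁ : win (a ⊕ s) (b ⊕ s) ≡ true
    win₁ = ∧-conicalˡ _ _ (∧-conicalˡ _ _ squareₛ)
    win₂ : win (a ⊕ s) s ≡ true
    win₂ = ∧-conicalˡ _ _ (∧-conicalʳ (win (a ⊕ s) (b ⊕ s) ∧ win (c ⊕ s ⊕ s) (b ⊕ s)) _ squareₛ)
    win₃ : win c s ≡ true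
    -- The vertex x′ = `c ⊕ s ⊕ s` collapses to `c`, so the walk starts at a vertex independent of
    -- `s`.
    win₃ = subst (λ v → win v s ≡ true) (⊕-cancel c s)
      (∧-conicalʳ (win (a ⊕ s) s) _
        (∧-conicalʳ (win (a ⊕ s) (b ⊕ s) ∧ win (c ⊕ s ⊕ s) (b ⊕ s)) _ squareₛ))
    win₄ : win (c ⊕ s ⊕ e) (b ⊕ s) ≡ true
    win₄ = ∧-conicalʳ (win (a ⊕ s) (b ⊕ s)) _ (∧-conicalˡ _ _ squareₑ)
    win₅ : win (c ⊕ s ⊕ e) e ≡ true
    win₅ = ∧-conicalʳ (win (a ⊕ s) e) _
      (∧-conicalʳ (win (a ⊕ s) (b ⊕ s) ∧ win (c ⊕ s ⊕ e) (b ⊕ s)) _ squareₑ)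

    lookup-⊕ : ∀ u v i → lookup (u ⊕ v) i ≡ lookup u i xor lookup v i
    lookup-⊕ u v i = lookup-zipWith _xor_ i u v

    edge₁ : ∀ i → (l f₁ (a ⊕ s) i xor l f₂ (b ⊕ s) i) xor l f₃ (a ⊕ b) i ≡
                  (lookup a i xor lookup s i) ∨ (lookup b i xor lookup s i)
    edge₁ i = trans (win⇒ (⊕-translate a b s) win₁ i)
                    (cong₂ _∨_ (lookup-⊕ a s i) (lookup-⊕ b s i))
    edge₂ : ∀ i → (l f₁ (a ⊕ s) i xor l f₂ s i) xor l f₃ a i ≡
                  (lookup a i xor lookup s i) ∨ lookup s i
    edge₂ i = trans (win⇒ (⊕-cancel a s) win₂ i) (cong (_∨ _) (lookup-⊕ a s i))
    edge₃ : ∀ i → (l f₁ c i xor l f₂ s i) xor l f₃ (c ⊕ s) i ≡ lookup c i ∨ lookup s i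
    edge₃ = win⇒ refl win₃
    lookup-cse : ∀ i → lookup (c ⊕ s ⊕ e) i ≡ (lookup c i xor lookup s i) xor lookup e i
    lookup-cse i = trans (lookup-⊕ (c ⊕ s) e i) (cong (_xor _) (lookup-⊕ c s i))
    edge₄ : ∀ i → (l f₁ (c ⊕ s ⊕ e) i xor l f₂ (b ⊕ s) i) xor l f₃ (c ⊕ e ⊕ b) i ≡
                  ((lookup c i xor lookup s i) xor lookup e i) ∨ (lookup b i xor lookup s i)
    edge₄ i = trans
      (win⇒ (trans (cong (_⊕ (b ⊕ s)) (⊕-swapʳ c s e)) (⊕-translate (c ⊕ e) b s)) win₄ i)
      (cong₂ _∨_ (lookup-cse i) (lookup-⊕ b s i))
    edge₅ : ∀ i → (l f₁ (c ⊕ s ⊕ e) i xor l f₂ e i) xor l f₃ (c ⊕ s) i ≡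
                  ((lookup c i xor lookup s i) xor lookup e i) ∨ lookup e i
    edge₅ i = trans (win⇒ (⊕-cancel (c ⊕ s) e) win₅ i) (cong (_∨ _) (lookup-cse i))

  -- After x, y, z are translated by `s`, the parameters `a`, `b`, `c`, `e` leave at most one `s`,
  -- namely `key a b c e`; each of the four contributes a factor `2 ^ n`.
  #gluedSquares≤ : #gluedSquares ≤ 2 ^ n * (2 ^ n * (2 ^ n * (2 ^ n * 1)))
  #gluedSquares≤ = begin
    #gluedSquares
      -- The sum over `s` must be outermost while x, y, z are translated by it; it is moved back
      -- afterwards.
      ≡⟨ rotate (λ x y z s → ∑[ e ] ⟦ gluedSquares x y z s e ⟧) ⟩
    (∑[ s ] ∑[ x ] ∑[ y ] ∑[ z ] ∑[ e ] ⟦ gluedSquares x y z s e ⟧)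
      ≡⟨ ∑-cong (λ s → translate₃ s λ x y z → ∑[ e ] ⟦ gluedSquares x y z s e ⟧) ⟩
    (∑[ s ] ∑[ a ] ∑[ b ] ∑[ c ] ∑[ e ] ⟦ gluedSquares (a ⊕ s) (b ⊕ s) (c ⊕ s) s e ⟧)
      ≡⟨ rotate (λ a b c s → ∑[ e ] ⟦ gluedSquares (a ⊕ s) (b ⊕ s) (c ⊕ s) s e ⟧) ⟨
    (∑[ a ] ∑[ b ] ∑[ c ] ∑[ s ] ∑[ e ] ⟦ gluedSquares (a ⊕ s) (b ⊕ s) (c ⊕ s) s e ⟧)
      ≤⟨ ∑≤ _ (λ a → ∑≤ _ λ b → ∑≤ _ λ c → ≤-trans
           (≤-reflexive (∑-swap λ s e → ⟦ gluedSquares (a ⊕ s) (b ⊕ s) (c ⊕ s) s e ⟧))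
           (∑≤ _ λ e → ∑-atMostOne (key a b c e)
                         (λ s → gluedSquares (a ⊕ s) (b ⊕ s) (c ⊕ s) s e)
                         (gluedSquares⇒key a b c e))) ⟩
    2 ^ n * (2 ^ n * (2 ^ n * (2 ^ n * 1))) ∎
    where
    open ≤-Reasoning
    rotate : (g : (x y z s : Vec Bool n) → ℕ) →
      (∑[ x ] ∑[ y ] ∑[ z ] ∑[ s ] g x y z s) ≡ (∑[ s ] ∑[ x ] ∑[ y ] ∑[ z ] g x y z s)
    rotate g = trans (∑-cong λ x → trans (∑-cong λ y → ∑-swap (g x y))
                                         (∑-swap λ y s → ∑[ z ] g x y z s))
                     (∑-swap λ x s → ∑[ y ] ∑[ z ] g x y z s)
    translate₃ : ∀ s (g : (x y z : Vec Bool n) → ℕ) →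
      (∑[ x ] ∑[ y ] ∑[ z ] g x y z) ≡ (∑[ a ] ∑[ b ] ∑[ c ] g (a ⊕ s) (b ⊕ s) (c ⊕ s))
    translate₃ s g = trans (∑-translate s λ x → ∑[ y ] ∑[ z ] g x y z)
      (∑-cong λ a → trans (∑-translate s λ y → ∑[ z ] g (a ⊕ s) y z)
        (∑-cong λ b → ∑-translate s (g (a ⊕ s) (b ⊕ s))))

-- Final arithmetic.

n≤2^n : ∀ n → n ≤ 2 ^ n
n≤2^n zero    = z≤n
n≤2^n (suc n) = +-mono-≤ (m^n>0 2 n) (≤-trans (n≤2^n n) (≤-reflexive (sym (+-identityʳ _))))

4^n≡2^n*2^n : ∀ n → 4 ^ n ≡ 2 ^ n * 2 ^ n
4^n≡2^n*2^n n = trans (^-*-assoc 2 2 n)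
  (trans (cong (λ m → 2 ^ (n + m)) (+-identityʳ n)) (^-distribˡ-+-* 2 n n))

-- The left side is `m ^ 8` unfolded; regrouping it as iterated squares lets bounds on squares be
-- substituted.
m^8≡[[m²]²]² : ∀ m → m * (m * (m * (m * (m * (m * (m * (m * 1))))))) ≡
            ((m * m) * (m * m)) * ((m * m) * (m * m))
m^8≡[[m²]²]² = solve-∀

-- The powers of N add up: e⁸ ≤ N⁴c⁴, c⁴ ≤ N⁴s², s² ≤ N³g and g ≤ N⁴ give e⁸ ≤ N¹⁵, one factor N
-- short of (N²)⁸.
chain-bound : ∀ N e c s g → e * e ≤ N * c → c * c ≤ N * (N * s) → s * s ≤ N * (N * N * g) →
              g ≤ N * (N * (N * (N * 1))) → e ^ 8 * N ≤ (N * N) ^ 8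
chain-bound N e c s g e² c² s² g≤ = begin
  e ^ 8 * N                      ≡⟨ cong (_* N) (m^8≡[[m²]²]² e) ⟩
  sq (sq (e * e)) * N            ≤⟨ *-monoˡ-≤ N (sq-mono (sq-mono e²)) ⟩
  sq (sq (N * c)) * N            ≡⟨ step₁ N c ⟩
  N⁵ * sq (c * c)                ≤⟨ *-monoʳ-≤ N⁵ (sq-mono c²) ⟩
  N⁵ * sq (N * (N * s))          ≡⟨ step₂ N s ⟩
  N⁵ * sq (N * N) * (s * s)      ≤⟨ *-monoʳ-≤ N⁹ s² ⟩
  N⁹ * (N * (N * N * g))         ≤⟨ *-monoʳ-≤ N⁹ (*-monoʳ-≤ N (*-monoʳ-≤ (N * N) g≤)) ⟩
  N⁹ * (N * (N * N * (N * (N * (N * (N * 1))))))  ≡⟨ step₃ N ⟩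
  sq (sq (sq (N * N)))           ≡⟨ m^8≡[[m²]²]² (N * N) ⟨
  (N * N) ^ 8                    ∎
  where
  open ≤-Reasoning
  sq : ℕ → ℕ
  sq m = m * m
  sq-mono : ∀ {m o} → m ≤ o → sq m ≤ sq o
  sq-mono m≤o = *-mono-≤ m≤o m≤o
  N⁵ N⁹ : ℕ
  N⁵ = N * sq (sq N)
  N⁹ = N⁵ * sq (N * N)
  step₁ : ∀ N c → ((N * c) * (N * c)) * ((N * c) * (N * c)) * N ≡
                  N * ((N * N) * (N * N)) * ((c * c) * (c * c))
  step₁ = solve-∀
  step₂ : ∀ N s → N * ((N * N) * (N * N)) * ((N * (N * s)) * (N * (N * s))) ≡
                  N * ((N * N) * (N * N)) * ((N * N) * (N * N)) * (s * s)
  step₂ = solve-∀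
  step₃ : ∀ N → N * ((N * N) * (N * N)) * ((N * N) * (N * N)) *
                  (N * (N * N * (N * (N * (N * (N * 1)))))) ≡
                (((N * N) * (N * N)) * ((N * N) * (N * N))) *
                (((N * N) * (N * N)) * ((N * N) * (N * N)))
  step₃ = solve-∀

theorem1p1 : ∃[ p ] ∃[ q ] ∃[ n₀ ] (1 ≤ p) × (1 ≤ q) ×
    (∀ n → n₀ ≤ n → (f₁ f₂ f₃ : Strategy n) →
    winCount n f₁ f₂ f₃ ^ q * n ^ p ≤ 4 ^ (n * q))
-- The exponent is c = 1/8, where 8 comes from three successive squarings; the bound holds from n =
-- 0 on.
theorem1p1 = 1 , 8 , 0 , ≤-refl , s≤s z≤n , bound
  where
  open ≤-Reasoning
  bound : ∀ n → 0 ≤ n → (f₁ f₂ f₃ : Strategy n) →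
          winCount n f₁ f₂ f₃ ^ 8 * n ^ 1 ≤ 4 ^ (n * 8)
  bound n _ f₁ f₂ f₃ = begin
    winCount n f₁ f₂ f₃ ^ 8 * n ^ 1  ≡⟨ cong₂ (λ m k → m ^ 8 * k) (winCount≡#edges f₁ f₂ f₃) (*-identityʳ n) ⟩
    -- Here the exponential gain `2 ^ n` is weakened to `n`.
    E ^ 8 * n                        ≤⟨ *-monoʳ-≤ (E ^ 8) (n≤2^n n) ⟩
    E ^ 8 * 2 ^ n                    ≤⟨ chain-bound (2 ^ n) E (#cherries f₁ f₂ f₃) (#squares f₁ f₂ f₃)
                                          (#gluedSquares f₁ f₂ f₃) (#edges² f₁ f₂ f₃)
                                          (#cherries² f₁ f₂ f₃) (#squares² f₁ f₂ f₃)
                                          (#gluedSquares≤ f₁ f₂ f₃) ⟩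
    (2 ^ n * 2 ^ n) ^ 8              ≡⟨ cong (_^ 8) (4^n≡2^n*2^n n) ⟨
    (4 ^ n) ^ 8                      ≡⟨ ^-*-assoc 4 n 8 ⟩
    4 ^ (n * 8)                      ∎
    where
    E = #edges f₁ f₂ f₃
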